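{- Let $(G_m)_{m\in\mathbb{Z}}$ be a generalized Fibonacci sequence, let $a,b$ be integers, let $n\ge 0$ be an integer, and let $x$ be a complex number such that $\Delta := 1-L_b x+(-1)^b x^2\neq 0$. Then $$\sum_{k=0}^n x^k k\, G_{a+bk} = -\frac{1}{\Delta}(n+1)x^{n+1} P(1,n+1) - \frac{1}{\Delta^2} \left[ x^{n+2} P(2,n+2) - x P(2,1) \right].$$
   Context: A generalized Fibonacci sequence is a sequence $(G_m)_{m\in\mathbb{Z}}$ of complex numbers with $G_{m+2}=G_{m+1}+G_m$ for all integers $m$ (with arbitrary seed $G_0,G_1$). $L_m$ is the Lucas number: $L_0=2$, $L_1=1$, $L_{m+2}=L_{m+1}+L_m$ for all integers $m$ (including negative indices). For given $a,b,x$ and $G$, and for integers $v,w\ge 0$, $P(v,w) = \sum_{k=0}^v \binom{v}{k} (-1)^{(b+1)k} x^k G_{a+bw-bk}$. Convention: $x^0=1$, also for $x=0$. -}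

module Defs where

open import Algebra.Bundles using (CommutativeRing)
open import Algebra.Structures using (IsCommutativeRing)
open import Data.Empty using (⊥-elim)
open import Data.Integer.Base as ℤ using (ℤ; +_; -[1+_])
import Data.Integer.Properties as ℤₚ
open import Data.Nat.Base as ℕ using (ℕ; zero; suc)
import Data.Nat.Properties as ℕₚ
open import Data.Nat.Combinatorics using (_C_)
open import Data.Fin.Base using (toℕ)
open import Data.Product.Base using (∃; _×_; _,_)
open import Data.Rational.Base as ℚ using (ℚ; 0ℚ; 1ℚ; ½)
import Data.Rational.Properties as ℚₚ
open import Data.Sum.Base using (inj₁; inj₂)
open import Level using (0ℓ)
open import Relation.Binary.Bundles using (Setoid)
open import Relation.Binary.PropositionalEquality
  using (_≡_; _≢_; refl; sym; trans; cong; cong₂; subst; subst₂)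
open import Relation.Binary.Structures using (IsEquivalence)
open import Relation.Nullary using (¬_; yes; no)
open import Relation.Nullary.Decidable using (dec⇒maybe)
open import Tactic.RingSolver using (solve-∀)
open import Tactic.RingSolver.Core.AlmostCommutativeRing
  using (AlmostCommutativeRing; fromCommutativeRing)

------------------------------------------------------------------------
-- Commutative rings from one-sided laws

module FromLeftLaws
  {A : Set} {_≈_ : A → A → Set} (isEquivalence : IsEquivalence _≈_)
  {_+_ _*_ : A → A → A} { -_ : A → A} {0# 1# : A}
  (+-cong      : ∀ {x y u v} → x ≈ y → u ≈ v → (x + u) ≈ (y + v))
  (*-cong      : ∀ {x y u v} → x ≈ y → u ≈ v → (x * u) ≈ (y * v))
  (-‿cong      : ∀ {x y} → x ≈ y → (- x) ≈ (- y))
  (+-assoc     : ∀ x y z → ((x + y) + z) ≈ (x + (y + z)))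
  (+-comm      : ∀ x y → (x + y) ≈ (y + x))
  (+-identityˡ : ∀ x → (0# + x) ≈ x)
  (-‿inverseˡ  : ∀ x → ((- x) + x) ≈ 0#)
  (*-assoc     : ∀ x y z → ((x * y) * z) ≈ (x * (y * z)))
  (*-comm      : ∀ x y → (x * y) ≈ (y * x))
  (*-identityˡ : ∀ x → (1# * x) ≈ x)
  (distribˡ    : ∀ x y z → (x * (y + z)) ≈ ((x * y) + (x * z)))
  where

  ≈-setoid : Setoid 0ℓ 0ℓ
  ≈-setoid = record { isEquivalence = isEquivalence }

  open import Algebra.Consequences.Setoid ≈-setoid
    using (comm∧idˡ⇒id; comm∧invˡ⇒inv; comm∧distrˡ⇒distr)

  isCommutativeRing : IsCommutativeRing _≈_ _+_ _*_ -_ 0# 1#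
  isCommutativeRing = record
    { isRing = record
      { +-isAbelianGroup = record
        { isGroup = record
          { isMonoid = record
            { isSemigroup = record
              { isMagma = record { isEquivalence = isEquivalence ; ∙-cong = +-cong }
              ; assoc = +-assoc
              }
            ; identity = comm∧idˡ⇒id +-comm +-identityˡ
            }
          ; inverse = comm∧invˡ⇒inv +-comm -‿inverseˡ
          ; ⁻¹-cong = -‿cong
          }
        ; comm = +-comm
        }
      ; *-cong = *-cong
      ; *-assoc = *-assoc
      ; *-identity = comm∧idˡ⇒id *-comm *-identityˡ
      ; distrib = comm∧distrˡ⇒distr +-cong *-comm distribˡ
      }
    ; *-comm = *-comm
    }

------------------------------------------------------------------------
-- Null double sequences of rationals

-- All the estimates needed for ℝ are about double sequences; a sequence f
-- is treated as the double sequence λ m n → f m.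

Null : (ℕ → ℕ → ℚ) → Set
Null f = ∀ ε → 0ℚ ℚ.< ε →
  ∃ λ N → ∀ m n → N ℕ.≤ m → N ℕ.≤ n → ℚ.∣ f m n ∣ ℚ.< ε

Bounded : (ℕ → ℕ → ℚ) → Set
Bounded f = ∃ λ B → 0ℚ ℚ.< B ×
  ∃ λ N → ∀ m n → N ℕ.≤ m → N ℕ.≤ n → ℚ.∣ f m n ∣ ℚ.≤ B

private
  ℚ-ring : AlmostCommutativeRing 0ℓ 0ℓ
  ℚ-ring = fromCommutativeRing ℚₚ.+-*-commutativeRing λ p → dec⇒maybe (0ℚ ℚₚ.≟ p)

  neg-diff : ∀ a b → ℚ.- (a ℚ.- b) ≡ b ℚ.- a
  neg-diff = solve-∀ ℚ-ring

  neg-diff′ : ∀ a b → ℚ.- (a ℚ.- b) ≡ ℚ.- a ℚ.- (ℚ.- b)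
  neg-diff′ = solve-∀ ℚ-ring

  diff-trans : ∀ a b c → (a ℚ.- b) ℚ.+ (b ℚ.- c) ≡ a ℚ.- c
  diff-trans = solve-∀ ℚ-ring

  add-diff : ∀ a b → a ≡ b ℚ.+ (a ℚ.- b)
  add-diff = solve-∀ ℚ-ring

  +-diff : ∀ a b c d → (a ℚ.- b) ℚ.+ (c ℚ.- d) ≡ (a ℚ.+ c) ℚ.- (b ℚ.+ d)
  +-diff = solve-∀ ℚ-ring

  *-diff : ∀ a b c d → a ℚ.* (c ℚ.- d) ℚ.+ d ℚ.* (a ℚ.- b) ≡ a ℚ.* c ℚ.- b ℚ.* d
  *-diff = solve-∀ ℚ-ring

  p≤∣p∣ : ∀ p → p ℚ.≤ ℚ.∣ p ∣
  p≤∣p∣ p with ℚₚ.≤-total 0ℚ p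
  ... | inj₁ 0≤p = ℚₚ.≤-reflexive (sym (ℚₚ.0≤p⇒∣p∣≡p 0≤p))
  ... | inj₂ p≤0 = ℚₚ.≤-trans p≤0 (ℚₚ.0≤∣p∣ p)

  ∣p∣²≡p² : ∀ p → ℚ.∣ p ∣ ℚ.* ℚ.∣ p ∣ ≡ p ℚ.* p
  ∣p∣²≡p² p with ℚₚ.∣p∣≡p∨∣p∣≡-p p
  ... | inj₁ eq = cong₂ ℚ._*_ eq eq
  ... | inj₂ eq = trans (cong₂ ℚ._*_ eq eq) (neg-square p)
    where
    neg-square : ∀ p → (ℚ.- p) ℚ.* (ℚ.- p) ≡ p ℚ.* p
    neg-square = solve-∀ ℚ-ring

  0≤p² : ∀ p → 0ℚ ℚ.≤ p ℚ.* p
  0≤p² p = subst₂ ℚ._≤_ (ℚₚ.*-zeroˡ ℚ.∣ p ∣) (∣p∣²≡p² p)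
    (ℚₚ.*-monoʳ-≤-nonNeg ℚ.∣ p ∣ {{ℚₚ.∣-∣-nonNeg p}} (ℚₚ.0≤∣p∣ p))

  p≤p+q² : ∀ p q → p ℚ.≤ p ℚ.+ q ℚ.* q
  p≤p+q² p q = subst (ℚ._≤ p ℚ.+ q ℚ.* q) (ℚₚ.+-identityʳ p) (ℚₚ.+-monoʳ-≤ p (0≤p² q))

  p≤q²+p : ∀ p q → p ℚ.≤ q ℚ.* q ℚ.+ p
  p≤q²+p p q = subst (p ℚ.≤_) (ℚₚ.+-comm p (q ℚ.* q)) (p≤p+q² p q)

  square<⇒∣∣< : ∀ {ε p} → 0ℚ ℚ.< ε → p ℚ.* p ℚ.< ε ℚ.* ε → ℚ.∣ p ∣ ℚ.< ε
  square<⇒∣∣< {ε} {p} 0<ε p²<ε² = ℚₚ.≰⇒> λ ε≤∣p∣ → ℚₚ.<-irrefl refl (begin-strict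
    ε ℚ.* ε              ≤⟨ ℚₚ.*-monoʳ-≤-nonNeg ε {{ε≥0}} ε≤∣p∣ ⟩
    ℚ.∣ p ∣ ℚ.* ε        ≤⟨ ℚₚ.*-monoˡ-≤-nonNeg ℚ.∣ p ∣ {{ℚₚ.∣-∣-nonNeg p}} ε≤∣p∣ ⟩
    ℚ.∣ p ∣ ℚ.* ℚ.∣ p ∣  ≡⟨ ∣p∣²≡p² p ⟩
    p ℚ.* p              <⟨ p²<ε² ⟩
    ε ℚ.* ε              ∎)
    where
    open ℚₚ.≤-Reasoning
    ε≥0 : ℚ.NonNegative ε
    ε≥0 = ℚₚ.pos⇒nonNeg ε {{ℚ.positive 0<ε}}

  *-rotate : ∀ b e r → b ℚ.* (e ℚ.* r) ≡ e ℚ.* (r ℚ.* b)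
  *-rotate = solve-∀ ℚ-ring

  inv-diff : ∀ p q r s → r ℚ.* s ℚ.* (ℚ.- (p ℚ.- q)) ≡ r ℚ.* (q ℚ.* s) ℚ.- s ℚ.* (p ℚ.* r)
  inv-diff = solve-∀ ℚ-ring

  half>0 : ∀ {ε} → 0ℚ ℚ.< ε → 0ℚ ℚ.< ε ℚ.* ½
  half>0 = ℚₚ.*-monoˡ-<-pos ½

  product>0 : ∀ {p q} → 0ℚ ℚ.< p → 0ℚ ℚ.< q → 0ℚ ℚ.< p ℚ.* q
  product>0 {p} {q} 0<p 0<q = subst (ℚ._< p ℚ.* q) (ℚₚ.*-zeroˡ q)
    (ℚₚ.*-monoˡ-<-pos q {{ℚ.positive 0<q}} 0<p)

  half+half : ∀ ε → ε ℚ.* ½ ℚ.+ ε ℚ.* ½ ≡ ε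
  half+half ε = trans (sym (ℚₚ.*-distribˡ-+ ε ½ ½)) (ℚₚ.*-identityʳ ε)

  ⊔ˡ : ∀ {M N k} → M ℕ.⊔ N ℕ.≤ k → M ℕ.≤ k
  ⊔ˡ {M} {N} = ℕₚ.≤-trans (ℕₚ.m≤m⊔n M N)

  ⊔ʳ : ∀ {M N k} → M ℕ.⊔ N ℕ.≤ k → N ℕ.≤ k
  ⊔ʳ {M} {N} = ℕₚ.≤-trans (ℕₚ.m≤n⊔m M N)

  recip>0 : ∀ {p} (0<p : 0ℚ ℚ.< p) →
            ∃ λ q → 0ℚ ℚ.< q × q ℚ.* p ≡ 1ℚ
  recip>0 {p} 0<p = q , ℚₚ.positive⁻¹ q , ℚₚ.*-inverseˡ p
    where
    instance
      pos = ℚ.positive 0<p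
      nz = ℚₚ.pos⇒nonZero p
    q = ℚ.1/ p
    instance
      posq = ℚₚ.1/pos⇒pos p

abstract
  null-cong : ∀ {f g} → (∃ λ N → ∀ m n → N ℕ.≤ m → N ℕ.≤ n → f m n ≡ g m n) →
              Null f → Null g
  null-cong (M , eq) nf ε 0<ε with nf ε 0<ε
  ... | N , h = M ℕ.⊔ N , λ m n p q →
    subst (λ z → ℚ.∣ z ∣ ℚ.< ε) (eq m n (⊔ˡ p) (⊔ˡ q)) (h m n (⊔ʳ p) (⊔ʳ q))

  null-≗ : ∀ {f g} → (∀ m n → f m n ≡ g m n) → Null f → Null g
  null-≗ eq = null-cong (0 , λ m n _ _ → eq m n)

  null-0 : Null (λ _ _ → 0ℚ)
  null-0 ε 0<ε = 0 , λ _ _ _ _ → 0<ε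

  null-+ : ∀ {f g} → Null f → Null g → Null (λ m n → f m n ℚ.+ g m n)
  null-+ {f} {g} nf ng ε 0<ε
    with nf _ (half>0 0<ε) | ng _ (half>0 0<ε)
  ... | M , hf | N , hg = M ℕ.⊔ N , λ m n p q →
    ℚₚ.≤-<-trans (ℚₚ.∣p+q∣≤∣p∣+∣q∣ (f m n) (g m n))
      (subst (ℚ.∣ f m n ∣ ℚ.+ ℚ.∣ g m n ∣ ℚ.<_) (half+half ε)
        (ℚₚ.+-mono-< (hf m n (⊔ˡ p) (⊔ˡ q)) (hg m n (⊔ʳ p) (⊔ʳ q))))

  null-neg : ∀ {f} → Null f → Null (λ m n → ℚ.- f m n)
  null-neg {f} nf ε 0<ε with nf ε 0<ε
  ... | N , h = N , λ m n p q →
    subst (ℚ._< ε) (sym (ℚₚ.∣-p∣≡∣p∣ (f m n))) (h m n p q)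

  null-* : ∀ {f g} → Bounded f → Null g → Null (λ m n → f m n ℚ.* g m n)
  null-* {f} {g} (B , 0<B , M , hf) ng ε 0<ε with recip>0 0<B
  ... | q , 0<q , q*B≡1 with ng (ε ℚ.* q) (product>0 0<ε 0<q)
  ... | N , hg = M ℕ.⊔ N , λ m n r s → begin-strict
    ℚ.∣ f m n ℚ.* g m n ∣            ≡⟨ ℚₚ.∣p*q∣≡∣p∣*∣q∣ (f m n) (g m n) ⟩
    ℚ.∣ f m n ∣ ℚ.* ℚ.∣ g m n ∣      ≤⟨ ℚₚ.*-monoʳ-≤-nonNeg ℚ.∣ g m n ∣
                                          {{ℚₚ.∣-∣-nonNeg (g m n)}}
                                          (hf m n (⊔ˡ r) (⊔ˡ s)) ⟩
    B ℚ.* ℚ.∣ g m n ∣                <⟨ ℚₚ.*-monoʳ-<-pos B {{ℚ.positive 0<B}}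
                                          (hg m n (⊔ʳ r) (⊔ʳ s)) ⟩
    B ℚ.* (ε ℚ.* q)                  ≡⟨ *-rotate B ε q ⟩
    ε ℚ.* (q ℚ.* B)                  ≡⟨ cong (ε ℚ.*_) q*B≡1 ⟩
    ε ℚ.* 1ℚ                         ≡⟨ ℚₚ.*-identityʳ ε ⟩
    ε                                ∎
    where open ℚₚ.≤-Reasoning

  bounded-* : ∀ {f g} → Bounded f → Bounded g → Bounded (λ m n → f m n ℚ.* g m n)
  bounded-* {f} {g} (B , 0<B , M , hf) (D , 0<D , N , hg) =
    B ℚ.* D , product>0 0<B 0<D , M ℕ.⊔ N , λ m n r s → begin
      ℚ.∣ f m n ℚ.* g m n ∣            ≡⟨ ℚₚ.∣p*q∣≡∣p∣*∣q∣ (f m n) (g m n) ⟩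
      ℚ.∣ f m n ∣ ℚ.* ℚ.∣ g m n ∣      ≤⟨ ℚₚ.*-monoʳ-≤-nonNeg ℚ.∣ g m n ∣
                                            {{ℚₚ.∣-∣-nonNeg (g m n)}}
                                            (hf m n (⊔ˡ r) (⊔ˡ s)) ⟩
      B ℚ.* ℚ.∣ g m n ∣                ≤⟨ ℚₚ.*-monoˡ-≤-nonNeg B
                                            {{ℚₚ.pos⇒nonNeg B {{ℚ.positive 0<B}}}}
                                            (hg m n (⊔ʳ r) (⊔ʳ s)) ⟩
      B ℚ.* D                          ∎
    where
    open ℚₚ.≤-Reasoning

------------------------------------------------------------------------
-- Real numbers: Cauchy sequences of rationals

-- No η, and operations defined by copatterns, so that terms such as x +ʳ y
-- do not unfold during unification; likewise for ℂ.
record ℝ : Set where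
  no-eta-equality
  field
    seq    : ℕ → ℚ
    cauchy : ∀ ε → 0ℚ ℚ.< ε →
             ∃ λ N → ∀ m n → N ℕ.≤ m → N ℕ.≤ n → ℚ.∣ seq m ℚ.- seq n ∣ ℚ.< ε

open ℝ public

infix 4 _≈ʳ_

record _≈ʳ_ (x y : ℝ) : Set where
  constructor mk≈ʳ
  field
    close : ∀ ε → 0ℚ ℚ.< ε →
            ∃ λ N → ∀ n → N ℕ.≤ n → ℚ.∣ seq x n ℚ.- seq y n ∣ ℚ.< ε

open _≈ʳ_ public

abstract
  ≈⇒null : ∀ {x y} → x ≈ʳ y → Null (λ m _ → seq x m ℚ.- seq y m)
  ≈⇒null e ε 0<ε with close e ε 0<ε
  ... | N , h = N , λ m _ p _ → h m p

  null⇒≈ : ∀ {x y} → Null (λ m _ → seq x m ℚ.- seq y m) → x ≈ʳ y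
  null⇒≈ nf = mk≈ʳ λ ε 0<ε → let N , h = nf ε 0<ε in N , λ n p → h n n p p

  ≗⇒≈ : ∀ {x y} → (∀ n → seq x n ≡ seq y n) → x ≈ʳ y
  ≗⇒≈ {x} {y} eq = null⇒≈ (null-≗ (λ m _ → sym
    (trans (cong (ℚ._- seq y m) (eq m)) (ℚₚ.+-inverseʳ (seq y m)))) null-0)

  ≈ʳ-isEquivalence : IsEquivalence _≈ʳ_
  ≈ʳ-isEquivalence = record
    { refl  = ≗⇒≈ (λ _ → refl)
    ; sym   = λ {x} {y} e → null⇒≈ (null-≗
        (λ m _ → neg-diff (seq x m) (seq y m))
        (null-neg (≈⇒null e)))
    ; trans = λ {x} {y} {z} e f → null⇒≈ (null-≗
        (λ m _ → diff-trans
                   (seq x m) (seq y m) (seq z m))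
        (null-+ (≈⇒null e) (≈⇒null f)))
    }

  bounded : ∀ x → Bounded (λ m _ → seq x m)
  bounded x with cauchy x 1ℚ (ℚₚ.positive⁻¹ 1ℚ)
  ... | N , h = ℚ.∣ seq x N ∣ ℚ.+ 1ℚ , 0<B , N , λ m _ p _ → begin
    ℚ.∣ seq x m ∣                                 ≡⟨ cong ℚ.∣_∣
      (add-diff (seq x m) (seq x N)) ⟩
    ℚ.∣ seq x N ℚ.+ (seq x m ℚ.- seq x N) ∣       ≤⟨ ℚₚ.∣p+q∣≤∣p∣+∣q∣ (seq x N) (seq x m ℚ.- seq x N) ⟩
    ℚ.∣ seq x N ∣ ℚ.+ ℚ.∣ seq x m ℚ.- seq x N ∣   ≤⟨ ℚₚ.+-monoʳ-≤ ℚ.∣ seq x N ∣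
      (ℚₚ.<⇒≤ (h m N p ℕₚ.≤-refl)) ⟩
    ℚ.∣ seq x N ∣ ℚ.+ 1ℚ                          ∎
    where
    open ℚₚ.≤-Reasoning
    0<B : 0ℚ ℚ.< ℚ.∣ seq x N ∣ ℚ.+ 1ℚ
    0<B = ℚₚ.+-mono-≤-< (ℚₚ.0≤∣p∣ (seq x N)) (ℚₚ.positive⁻¹ 1ℚ)

  flip-bounded : ∀ {f : ℕ → ℚ} → Bounded (λ m _ → f m) → Bounded (λ _ n → f n)
  flip-bounded (B , 0<B , N , h) = B , 0<B , N , λ m n p q → h n m q p

infixl 6 _+ʳ_
infixl 7 _*ʳ_
infix  8 -ʳ_

fromℚ : ℚ → ℝ
seq (fromℚ q) _ = q
cauchy (fromℚ q) = constant
  where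
  abstract
    constant : Null (λ _ _ → q ℚ.- q)
    constant = null-≗ (λ _ _ → sym (ℚₚ.+-inverseʳ q)) null-0

0ʳ 1ʳ : ℝ
0ʳ = fromℚ 0ℚ
1ʳ = fromℚ 1ℚ

_+ʳ_ : ℝ → ℝ → ℝ
seq (x +ʳ y) n = seq x n ℚ.+ seq y n
cauchy (x +ʳ y) = +-cauchy
  where
  abstract
    +-cauchy : Null (λ m n → (seq x m ℚ.+ seq y m) ℚ.- (seq x n ℚ.+ seq y n))
    +-cauchy = null-≗
      (λ m n → +-diff
                 (seq x m) (seq x n) (seq y m) (seq y n))
      (null-+ (cauchy x) (cauchy y))

-ʳ_ : ℝ → ℝ
seq (-ʳ x) n = ℚ.- seq x n
cauchy (-ʳ x) = neg-cauchy
  where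
  abstract
    neg-cauchy : Null (λ m n → ℚ.- seq x m ℚ.- (ℚ.- seq x n))
    neg-cauchy = null-≗
      (λ m n → neg-diff′ (seq x m) (seq x n))
      (null-neg (cauchy x))

_*ʳ_ : ℝ → ℝ → ℝ
seq (x *ʳ y) n = seq x n ℚ.* seq y n
cauchy (x *ʳ y) = *-cauchy
  where
  abstract
    *-cauchy : Null (λ m n → seq x m ℚ.* seq y m ℚ.- seq x n ℚ.* seq y n)
    *-cauchy = null-≗
      (λ m n → *-diff
                 (seq x m) (seq x n) (seq y m) (seq y n))
      (null-+ (null-* (bounded x) (cauchy y))
              (null-* (flip-bounded (bounded y)) (cauchy x)))

private
  abstract
    +ʳ-cong : ∀ {x y u v} → x ≈ʳ y → u ≈ʳ v → x +ʳ u ≈ʳ y +ʳ v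
    +ʳ-cong {x} {y} {u} {v} e f = null⇒≈ (null-≗
      (λ m _ → +-diff
                 (seq x m) (seq y m) (seq u m) (seq v m))
      (null-+ (≈⇒null e) (≈⇒null f)))

    -ʳ-cong : ∀ {x y} → x ≈ʳ y → -ʳ x ≈ʳ -ʳ y
    -ʳ-cong {x} {y} e = null⇒≈ (null-≗
      (λ m _ → neg-diff′ (seq x m) (seq y m))
      (null-neg (≈⇒null e)))

    *ʳ-cong : ∀ {x y u v} → x ≈ʳ y → u ≈ʳ v → x *ʳ u ≈ʳ y *ʳ v
    *ʳ-cong {x} {y} {u} {v} e f = null⇒≈ (null-≗
      (λ m _ → *-diff
                 (seq x m) (seq y m) (seq u m) (seq v m))
      (null-+ (null-* (bounded x) (≈⇒null f)) (null-* (bounded v) (≈⇒null e))))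

    +ʳ-assoc : ∀ x y z → (x +ʳ y) +ʳ z ≈ʳ x +ʳ (y +ʳ z)
    +ʳ-assoc x y z = ≗⇒≈ λ n → ℚₚ.+-assoc (seq x n) (seq y n) (seq z n)

    +ʳ-comm : ∀ x y → x +ʳ y ≈ʳ y +ʳ x
    +ʳ-comm x y = ≗⇒≈ λ n → ℚₚ.+-comm (seq x n) (seq y n)

    +ʳ-identityˡ : ∀ x → 0ʳ +ʳ x ≈ʳ x
    +ʳ-identityˡ x = ≗⇒≈ λ n → ℚₚ.+-identityˡ (seq x n)

    -ʳ-inverseˡ : ∀ x → (-ʳ x) +ʳ x ≈ʳ 0ʳ
    -ʳ-inverseˡ x = ≗⇒≈ λ n → ℚₚ.+-inverseˡ (seq x n)

    *ʳ-assoc : ∀ x y z → (x *ʳ y) *ʳ z ≈ʳ x *ʳ (y *ʳ z)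
    *ʳ-assoc x y z = ≗⇒≈ λ n → ℚₚ.*-assoc (seq x n) (seq y n) (seq z n)

    *ʳ-comm : ∀ x y → x *ʳ y ≈ʳ y *ʳ x
    *ʳ-comm x y = ≗⇒≈ λ n → ℚₚ.*-comm (seq x n) (seq y n)

    *ʳ-identityˡ : ∀ x → 1ʳ *ʳ x ≈ʳ x
    *ʳ-identityˡ x = ≗⇒≈ λ n → ℚₚ.*-identityˡ (seq x n)

    *ʳ-distribˡ : ∀ x y z → x *ʳ (y +ʳ z) ≈ʳ (x *ʳ y) +ʳ (x *ʳ z)
    *ʳ-distribˡ x y z = ≗⇒≈ λ n → ℚₚ.*-distribˡ-+ (seq x n) (seq y n) (seq z n)


ℝ-commutativeRing : CommutativeRing 0ℓ 0ℓ
ℝ-commutativeRing = record { isCommutativeRing = FromLeftLaws.isCommutativeRing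
  ≈ʳ-isEquivalence +ʳ-cong *ʳ-cong -ʳ-cong +ʳ-assoc +ʳ-comm +ʳ-identityˡ -ʳ-inverseˡ
  *ʳ-assoc *ʳ-comm *ʳ-identityˡ *ʳ-distribˡ }

Positive : ℝ → Set
Positive x = ∃ λ ε → 0ℚ ℚ.< ε × ∃ λ N → ∀ n → N ℕ.≤ n → ε ℚ.≤ seq x n

-- The junk value at 0 does not matter: a positive real has only finitely
-- many non-positive terms.
recip : ℚ → ℚ
recip p with p ℚₚ.≟ 0ℚ
... | yes _  = 0ℚ
... | no p≢0 = (ℚ.1/ p) {{ℚ.≢-nonZero p≢0}}

private
  abstract
    *-recip : ∀ {p} → p ≢ 0ℚ → p ℚ.* recip p ≡ 1ℚ
    *-recip {p} p≢0 with p ℚₚ.≟ 0ℚ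
    ... | yes p≡0 = ⊥-elim (p≢0 p≡0)
    ... | no p≢0′ = ℚₚ.*-inverseʳ p {{ℚ.≢-nonZero p≢0′}}

    ≥ε⇒≢0 : ∀ {ε p} → 0ℚ ℚ.< ε → ε ℚ.≤ p → p ≢ 0ℚ
    ≥ε⇒≢0 0<ε ε≤p p≡0 = ℚₚ.<-irrefl (sym p≡0) (ℚₚ.<-≤-trans 0<ε ε≤p)

    recip-bounded : ∀ x → Positive x → Bounded (λ m _ → recip (seq x m))
    recip-bounded x (ε , 0<ε , N , h) with recip>0 0<ε
    ... | q , 0<q , q*ε≡1 = q , 0<q , N , λ m _ p _ →
      ℚₚ.*-cancelˡ-≤-pos ε {{ℚ.positive 0<ε}} (begin
        ε ℚ.* ℚ.∣ recip (seq x m) ∣              ≤⟨ ℚₚ.*-monoʳ-≤-nonNeg ℚ.∣ recip (seq x m) ∣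
                                                      {{ℚₚ.∣-∣-nonNeg (recip (seq x m))}} (h m p) ⟩
        seq x m ℚ.* ℚ.∣ recip (seq x m) ∣        ≡⟨ cong (ℚ._* ℚ.∣ recip (seq x m) ∣) (sym
                                                      (ℚₚ.0≤p⇒∣p∣≡p (ℚₚ.≤-trans (ℚₚ.<⇒≤ 0<ε) (h m p)))) ⟩
        ℚ.∣ seq x m ∣ ℚ.* ℚ.∣ recip (seq x m) ∣  ≡⟨ sym (ℚₚ.∣p*q∣≡∣p∣*∣q∣ (seq x m) _) ⟩
        ℚ.∣ seq x m ℚ.* recip (seq x m) ∣        ≡⟨ cong ℚ.∣_∣ (*-recip (≥ε⇒≢0 0<ε (h m p))) ⟩
        1ℚ                                       ≡⟨ trans (sym q*ε≡1) (ℚₚ.*-comm q ε) ⟩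
        ε ℚ.* q                                  ∎)
      where open ℚₚ.≤-Reasoning

    recip-diff : ∀ p q r s → p ℚ.* r ≡ 1ℚ → q ℚ.* s ≡ 1ℚ →
                 r ℚ.* s ℚ.* (ℚ.- (p ℚ.- q)) ≡ r ℚ.- s
    recip-diff p q r s pr qs = begin-equality
      r ℚ.* s ℚ.* (ℚ.- (p ℚ.- q))            ≡⟨ inv-diff p q r s ⟩
      r ℚ.* (q ℚ.* s) ℚ.- s ℚ.* (p ℚ.* r)    ≡⟨ cong₂ (λ t u → r ℚ.* t ℚ.- s ℚ.* u) qs pr ⟩
      r ℚ.* 1ℚ ℚ.- s ℚ.* 1ℚ                  ≡⟨ cong₂ ℚ._-_ (ℚₚ.*-identityʳ r) (ℚₚ.*-identityʳ s) ⟩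
      r ℚ.- s                                ∎
      where open ℚₚ.≤-Reasoning

invʳ : (x : ℝ) → Positive x → ℝ
seq (invʳ x x>0) n = recip (seq x n)
cauchy (invʳ x x>0) = inv-cauchy
  where
  abstract
    inv-cauchy : Null (λ m n → recip (seq x m) ℚ.- recip (seq x n))
    inv-cauchy = let ε , 0<ε , N , h = x>0 in
      null-cong (N , λ m n p q → recip-diff (seq x m) (seq x n) _ _
                   (*-recip (≥ε⇒≢0 0<ε (h m p))) (*-recip (≥ε⇒≢0 0<ε (h n q))))
        (null-* (bounded-* (recip-bounded x x>0) (flip-bounded (recip-bounded x x>0)))
                (null-neg (cauchy x)))

abstract
  *ʳ-inverse : ∀ x (x>0 : Positive x) → x *ʳ invʳ x x>0 ≈ʳ 1ʳ
  *ʳ-inverse x (ε , 0<ε , N , h) = null⇒≈ (null-cong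
    (N , λ m _ p _ → sym (trans (cong (ℚ._- 1ℚ) (*-recip (≥ε⇒≢0 0<ε (h m p))))
                                (ℚₚ.+-inverseʳ 1ℚ)))
    null-0)

  ≈0⇒¬positive : ∀ {x} → x ≈ʳ 0ʳ → ¬ Positive x
  ≈0⇒¬positive {x} x≈0 (ε , 0<ε , N , h) with close x≈0 ε 0<ε
  ... | M , g = ℚₚ.<-irrefl refl (begin-strict
    ε                        ≤⟨ h k (ℕₚ.m≤n⊔m M N) ⟩
    seq x k                  ≡⟨ sym (ℚₚ.+-identityʳ (seq x k)) ⟩
    seq x k ℚ.- 0ℚ           ≤⟨ p≤∣p∣ (seq x k ℚ.- 0ℚ) ⟩
    ℚ.∣ seq x k ℚ.- 0ℚ ∣     <⟨ g k (ℕₚ.m≤m⊔n M N) ⟩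
    ε                        ∎)
    where
    open ℚₚ.≤-Reasoning
    k : ℕ
    k = M ℕ.⊔ N

  -- Beyond the index where x varies by less than ε/2, one term ≥ ε would
  -- keep all later terms above ε/2.
  ¬positive⇒eventually< : ∀ {x} → ¬ Positive x → ∀ ε → 0ℚ ℚ.< ε →
    ∃ λ N → ∀ n → N ℕ.≤ n → seq x n ℚ.< ε
  ¬positive⇒eventually< {x} ¬x>0 ε 0<ε with cauchy x (ε ℚ.* ½) (half>0 0<ε)
  ... | N , h = N , λ n N≤n → ℚₚ.≰⇒> λ ε≤xₙ →
    ¬x>0 (ε ℚ.* ½ , half>0 0<ε , N , λ m N≤m → ℚₚ.≮⇒≥ λ xₘ<ε/2 →
      ℚₚ.<-irrefl refl (begin-strict
        ε                                      ≤⟨ ε≤xₙ ⟩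
        seq x n                                ≡⟨ add-diff (seq x n) (seq x m) ⟩
        seq x m ℚ.+ (seq x n ℚ.- seq x m)      ≤⟨ ℚₚ.+-monoʳ-≤ (seq x m)
                                                    (p≤∣p∣ (seq x n ℚ.- seq x m)) ⟩
        seq x m ℚ.+ ℚ.∣ seq x n ℚ.- seq x m ∣  <⟨ ℚₚ.+-mono-< xₘ<ε/2 (h n m N≤n N≤m) ⟩
        ε ℚ.* ½ ℚ.+ ε ℚ.* ½                    ≡⟨ half+half ε ⟩
        ε                                      ∎))
    where open ℚₚ.≤-Reasoning

------------------------------------------------------------------------
-- Complex numbers

record ℂ : Set where
  no-eta-equality
  field
    re im : ℝ

open ℂ public

infix 4 _≈ᶜ_

record _≈ᶜ_ (z w : ℂ) : Set where
  constructor _,_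
  field
    re≈ : re z ≈ʳ re w
    im≈ : im z ≈ʳ im w

open _≈ᶜ_ public

infixl 6 _+ᶜ_
infixl 7 _*ᶜ_
infix  8 -ᶜ_

fromℝ : ℝ → ℂ
re (fromℝ x) = x
im (fromℝ x) = 0ʳ

0ᶜ 1ᶜ : ℂ
0ᶜ = fromℝ 0ʳ
1ᶜ = fromℝ 1ʳ

_+ᶜ_ : ℂ → ℂ → ℂ
re (z +ᶜ w) = re z +ʳ re w
im (z +ᶜ w) = im z +ʳ im w

-ᶜ_ : ℂ → ℂ
re (-ᶜ z) = -ʳ re z
im (-ᶜ z) = -ʳ im z

_*ᶜ_ : ℂ → ℂ → ℂ
re (z *ᶜ w) = re z *ʳ re w +ʳ -ʳ (im z *ʳ im w)
im (z *ᶜ w) = re z *ʳ im w +ʳ im z *ʳ re w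

private
  *-assoc-re : ∀ a b c d e f →
    (a ℚ.* c ℚ.+ ℚ.- (b ℚ.* d)) ℚ.* e ℚ.+ ℚ.- ((a ℚ.* d ℚ.+ b ℚ.* c) ℚ.* f) ≡
    a ℚ.* (c ℚ.* e ℚ.+ ℚ.- (d ℚ.* f)) ℚ.+ ℚ.- (b ℚ.* (c ℚ.* f ℚ.+ d ℚ.* e))
  *-assoc-re = solve-∀ ℚ-ring

  *-assoc-im : ∀ a b c d e f →
    (a ℚ.* c ℚ.+ ℚ.- (b ℚ.* d)) ℚ.* f ℚ.+ (a ℚ.* d ℚ.+ b ℚ.* c) ℚ.* e ≡
    a ℚ.* (c ℚ.* f ℚ.+ d ℚ.* e) ℚ.+ b ℚ.* (c ℚ.* e ℚ.+ ℚ.- (d ℚ.* f))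
  *-assoc-im = solve-∀ ℚ-ring

  *-comm-re : ∀ a b c d → a ℚ.* c ℚ.+ ℚ.- (b ℚ.* d) ≡ c ℚ.* a ℚ.+ ℚ.- (d ℚ.* b)
  *-comm-re = solve-∀ ℚ-ring

  *-comm-im : ∀ a b c d → a ℚ.* d ℚ.+ b ℚ.* c ≡ c ℚ.* b ℚ.+ d ℚ.* a
  *-comm-im = solve-∀ ℚ-ring

  *-identityˡ-re : ∀ a b → 1ℚ ℚ.* a ℚ.+ ℚ.- (0ℚ ℚ.* b) ≡ a
  *-identityˡ-re = solve-∀ ℚ-ring

  *-identityˡ-im : ∀ a b → 1ℚ ℚ.* b ℚ.+ 0ℚ ℚ.* a ≡ b
  *-identityˡ-im = solve-∀ ℚ-ring

  distribˡ-re : ∀ a b c d e f →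
    a ℚ.* (c ℚ.+ e) ℚ.+ ℚ.- (b ℚ.* (d ℚ.+ f)) ≡
    (a ℚ.* c ℚ.+ ℚ.- (b ℚ.* d)) ℚ.+ (a ℚ.* e ℚ.+ ℚ.- (b ℚ.* f))
  distribˡ-re = solve-∀ ℚ-ring

  distribˡ-im : ∀ a b c d e f →
    a ℚ.* (d ℚ.+ f) ℚ.+ b ℚ.* (c ℚ.+ e) ≡
    (a ℚ.* d ℚ.+ b ℚ.* c) ℚ.+ (a ℚ.* f ℚ.+ b ℚ.* e)
  distribˡ-im = solve-∀ ℚ-ring

  inverse-re : ∀ a b r → a ℚ.* (a ℚ.* r) ℚ.+ ℚ.- (b ℚ.* (ℚ.- b ℚ.* r)) ≡
                         (a ℚ.* a ℚ.+ b ℚ.* b) ℚ.* r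
  inverse-re = solve-∀ ℚ-ring

  inverse-im : ∀ a b r → a ℚ.* (ℚ.- b ℚ.* r) ℚ.+ b ℚ.* (a ℚ.* r) ≡ 0ℚ
  inverse-im = solve-∀ ℚ-ring

  reₙ imₙ : ℂ → ℕ → ℚ
  reₙ z = seq (re z)
  imₙ z = seq (im z)

  abstract
    ≈ᶜ-isEquivalence : IsEquivalence _≈ᶜ_
    ≈ᶜ-isEquivalence = record
      { refl  = E.refl , E.refl
      ; sym   = λ (p , q) → E.sym p , E.sym q
      ; trans = λ (p , q) (r , s) → E.trans p r , E.trans q s
      }
      where module E = IsEquivalence ≈ʳ-isEquivalence

    +ᶜ-cong : ∀ {x y u v} → x ≈ᶜ y → u ≈ᶜ v → x +ᶜ u ≈ᶜ y +ᶜ v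
    +ᶜ-cong (p , q) (r , s) = +ʳ-cong p r , +ʳ-cong q s

    -ᶜ-cong : ∀ {x y} → x ≈ᶜ y → -ᶜ x ≈ᶜ -ᶜ y
    -ᶜ-cong (p , q) = -ʳ-cong p , -ʳ-cong q

    *ᶜ-cong : ∀ {x y u v} → x ≈ᶜ y → u ≈ᶜ v → x *ᶜ u ≈ᶜ y *ᶜ v
    *ᶜ-cong (p , q) (r , s) =
      +ʳ-cong (*ʳ-cong p r) (-ʳ-cong (*ʳ-cong q s)) ,
      +ʳ-cong (*ʳ-cong p s) (*ʳ-cong q r)

    +ᶜ-assoc : ∀ x y z → (x +ᶜ y) +ᶜ z ≈ᶜ x +ᶜ (y +ᶜ z)
    +ᶜ-assoc x y z = +ʳ-assoc (re x) (re y) (re z) , +ʳ-assoc (im x) (im y) (im z)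

    +ᶜ-comm : ∀ x y → x +ᶜ y ≈ᶜ y +ᶜ x
    +ᶜ-comm x y = +ʳ-comm (re x) (re y) , +ʳ-comm (im x) (im y)

    +ᶜ-identityˡ : ∀ x → 0ᶜ +ᶜ x ≈ᶜ x
    +ᶜ-identityˡ x = +ʳ-identityˡ (re x) , +ʳ-identityˡ (im x)

    -ᶜ-inverseˡ : ∀ x → (-ᶜ x) +ᶜ x ≈ᶜ 0ᶜ
    -ᶜ-inverseˡ x = -ʳ-inverseˡ (re x) , -ʳ-inverseˡ (im x)

    *ᶜ-assoc : ∀ x y z → (x *ᶜ y) *ᶜ z ≈ᶜ x *ᶜ (y *ᶜ z)
    *ᶜ-assoc x y z =
      ≗⇒≈ (λ n → *-assoc-re (reₙ x n) (imₙ x n) (reₙ y n) (imₙ y n) (reₙ z n) (imₙ z n)) ,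
      ≗⇒≈ (λ n → *-assoc-im (reₙ x n) (imₙ x n) (reₙ y n) (imₙ y n) (reₙ z n) (imₙ z n))

    *ᶜ-comm : ∀ x y → x *ᶜ y ≈ᶜ y *ᶜ x
    *ᶜ-comm x y =
      ≗⇒≈ (λ n → *-comm-re (reₙ x n) (imₙ x n) (reₙ y n) (imₙ y n)) ,
      ≗⇒≈ (λ n → *-comm-im (reₙ x n) (imₙ x n) (reₙ y n) (imₙ y n))

    *ᶜ-identityˡ : ∀ x → 1ᶜ *ᶜ x ≈ᶜ x
    *ᶜ-identityˡ x =
      ≗⇒≈ (λ n → *-identityˡ-re (reₙ x n) (imₙ x n)) ,
      ≗⇒≈ (λ n → *-identityˡ-im (reₙ x n) (imₙ x n))

    *ᶜ-distribˡ : ∀ x y z → x *ᶜ (y +ᶜ z) ≈ᶜ (x *ᶜ y) +ᶜ (x *ᶜ z)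
    *ᶜ-distribˡ x y z =
      ≗⇒≈ (λ n → distribˡ-re (reₙ x n) (imₙ x n) (reₙ y n) (imₙ y n) (reₙ z n) (imₙ z n)) ,
      ≗⇒≈ (λ n → distribˡ-im (reₙ x n) (imₙ x n) (reₙ y n) (imₙ y n) (reₙ z n) (imₙ z n))

ℂ-commutativeRing : CommutativeRing 0ℓ 0ℓ
ℂ-commutativeRing = record { isCommutativeRing = FromLeftLaws.isCommutativeRing
  ≈ᶜ-isEquivalence +ᶜ-cong *ᶜ-cong -ᶜ-cong +ᶜ-assoc +ᶜ-comm +ᶜ-identityˡ -ᶜ-inverseˡ
  *ᶜ-assoc *ᶜ-comm *ᶜ-identityˡ *ᶜ-distribˡ }

open CommutativeRing ℂ-commutativeRing public
  using (_≈_; _+_; _*_; -_; _-_; 0#; 1#)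
open import Algebra.Properties.Semiring.Exp (CommutativeRing.semiring ℂ-commutativeRing) public
  using (_^_)
open import Algebra.Properties.CommutativeMonoid.Sum
  (CommutativeRing.+-commutativeMonoid ℂ-commutativeRing) public
  using (sum; sum⁺-syntax)

∣_∣² : ℂ → ℝ
∣ z ∣² = re z *ʳ re z +ʳ im z *ʳ im z

infix 4 _#0

-- Constructively, z ≠ 0 as needed for dividing by z is apartness from 0;
-- ≉0⇒¬¬#0 and #0⇒≉0 below show that it is classically just ¬ (z ≈ 0#).
_#0 : ℂ → Set
z #0 = Positive ∣ z ∣²

inv : (z : ℂ) → z #0 → ℂ
re (inv z z#0) = re z *ʳ invʳ ∣ z ∣² z#0
im (inv z z#0) = -ʳ im z *ʳ invʳ ∣ z ∣² z#0

abstract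
  *-inverse : ∀ z (z#0 : z #0) → z * inv z z#0 ≈ 1#
  *-inverse z z#0 =
    E.trans (≗⇒≈ (λ n → inverse-re (reₙ z n) (imₙ z n) (recip (seq ∣ z ∣² n))))
            (*ʳ-inverse ∣ z ∣² z#0) ,
    ≗⇒≈ (λ n → inverse-im (reₙ z n) (imₙ z n) (recip (seq ∣ z ∣² n)))
    where module E = IsEquivalence ≈ʳ-isEquivalence

  #0⇒≉0 : ∀ {z} → z #0 → ¬ z ≈ 0#
  #0⇒≉0 {z} z#0 (p , q) = ≈0⇒¬positive
    (E.trans (+ʳ-cong (*ʳ-cong p p) (*ʳ-cong q q)) (≗⇒≈ {0ʳ *ʳ 0ʳ +ʳ 0ʳ *ʳ 0ʳ} {0ʳ} (λ _ → refl))) z#0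
    where module E = IsEquivalence ≈ʳ-isEquivalence

  ¬#0⇒≈0 : ∀ {z} → ¬ z #0 → z ≈ 0#
  ¬#0⇒≈0 {z} ¬z#0 = small (re z) (λ n → p≤p+q² (reₙ z n ℚ.* reₙ z n) (imₙ z n))
                  , small (im z) (λ n → p≤q²+p (imₙ z n ℚ.* imₙ z n) (reₙ z n))
    where
    small : ∀ x → (∀ n → seq x n ℚ.* seq x n ℚ.≤ seq ∣ z ∣² n) → x ≈ʳ 0ʳ
    small x x²≤ = mk≈ʳ λ ε 0<ε →
      let N , h = ¬positive⇒eventually< {∣ z ∣²} ¬z#0 (ε ℚ.* ε) (product>0 0<ε 0<ε) in
      N , λ n N≤n → subst (λ t → ℚ.∣ t ∣ ℚ.< ε) (sym (ℚₚ.+-identityʳ (seq x n)))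
        (square<⇒∣∣< 0<ε (ℚₚ.≤-<-trans (x²≤ n) (h n N≤n)))

  ≉0⇒¬¬#0 : ∀ {z} → ¬ z ≈ 0# → ¬ ¬ z #0
  ≉0⇒¬¬#0 z≉0 ¬z#0 = z≉0 (¬#0⇒≈0 ¬z#0)

fromℤ : ℤ → ℂ
fromℤ i = fromℝ (fromℚ (i ℚ./ 1))

------------------------------------------------------------------------
-- Generalized Fibonacci and Lucas numbers

GeneralizedFibonacci : (ℤ → ℂ) → Set
GeneralizedFibonacci G = ∀ m → G (m ℤ.+ + 2) ≈ G (m ℤ.+ + 1) + G m

-- For negative indices the recurrence is run backwards; lucas-rec below
-- shows that it holds at every integer.
lucas : ℤ → ℤ
lucas (+ 0)               = + 2
lucas (+ 1)               = + 1
lucas (+ suc (suc n))     = lucas (+ suc n) ℤ.+ lucas (+ n)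
lucas -[1+ 0 ]            = -[1+ 0 ]
lucas -[1+ 1 ]            = + 3
lucas -[1+ suc (suc n) ]  = lucas -[1+ n ] ℤ.- lucas -[1+ suc n ]

lucas-rec : ∀ m → lucas (m ℤ.+ + 2) ≡ lucas (m ℤ.+ + 1) ℤ.+ lucas m
lucas-rec (+ n) rewrite ℕₚ.+-comm n 2 | ℕₚ.+-comm n 1 = refl
lucas-rec -[1+ 0 ] = refl
lucas-rec -[1+ 1 ] = refl
lucas-rec -[1+ suc (suc n) ] = backwards (lucas -[1+ n ]) (lucas -[1+ suc n ])
  where
  backwards : ∀ i j → i ≡ j ℤ.+ (i ℤ.- j)
  backwards i j = sym (trans (ℤₚ.+-comm j (i ℤ.- j)) (trans (ℤₚ.+-assoc i (ℤ.- j) j)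
    (trans (cong (λ t → i ℤ.+ t) (ℤₚ.+-inverseˡ j)) (ℤₚ.+-identityʳ i))))

-- (-1)^m for integer m; the sign of m is irrelevant since (-1)⁻¹ = -1.
[-1]^_ : ℤ → ℂ
[-1]^ m = (- 1#) ^ ℤ.∣ m ∣

P : (ℤ → ℂ) → ℤ → ℤ → ℂ → ℕ → ℕ → ℂ
P G a b x v w = ∑[ k ≤ v ]
  (fromℤ (+ (v C toℕ k)) * [-1]^ ((b ℤ.+ + 1) ℤ.* + toℕ k) * x ^ toℕ k
    * G (a ℤ.+ b ℤ.* + w ℤ.- b ℤ.* + toℕ k))

Δ : ℤ → ℂ → ℂ
Δ b x = 1# - fromℤ (lucas b) * x + [-1]^ b * x ^ 2

{-# OPTIONS --safe #-}

-- Put q = (-1)^b and H k = G (a + b k). Then H (k+1) = L_b H k - q H (k-1), and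
-- Δ = 1 - L_b x + q x² factors as (1 - x E) (1 - q x E⁻¹) on solutions of this
-- recurrence, E being the shift. With D = 1 - q x E⁻¹ this reads
-- Δ F k = D F k - x D F (k+1). As P(1,w) = D H w and P(2,w) = D² H w, applying
-- it to H and to D H makes the sum telescope twice.

module Submission where

open import Algebra.Bundles using (CommutativeRing)
import Algebra.Properties.Monoid.Sum as Sum
import Algebra.Properties.Semiring.Exp as Exp
import Algebra.Solver.Ring as RingSolver
open import Algebra.Solver.Ring.AlmostCommutativeRing
  using (fromCommutativeRing; _-Raw-AlmostCommutative⟶_)
open import Data.Fin using (toℕ)
import Data.Fin.Properties as Finₚ
open import Data.Integer as ℤ using (ℤ; +_; -[1+_])
import Data.Integer.Properties as ℤₚ
import Data.Integer.Tactic.RingSolver as ℤ-Solver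
open import Data.Maybe.Base using (just; nothing)
open import Data.Nat as ℕ using (ℕ; zero; suc)
open import Data.Nat.Combinatorics using (_C_)
import Data.Nat.Properties as ℕₚ
open import Data.Rational as ℚ using ()
import Data.Rational.Properties as ℚₚ
open import Data.Rational.Unnormalised as ℚᵘ using (mkℚᵘ; *≡*)
import Data.Rational.Unnormalised.Properties as ℚᵘₚ
open import Relation.Binary.Definitions using (WeaklyDecidable)
open import Relation.Binary.PropositionalEquality as ≡ using (_≡_)
import Relation.Binary.Reasoning.Setoid as SetoidReasoning
open import Relation.Nullary.Decidable using (yes; no)
open import Defs

open CommutativeRing ℂ-commutativeRing
  using ( setoid; semiring; +-monoid; +-cong; +-congˡ; +-congʳ; *-cong; *-congˡ; *-congʳ
        ; -‿cong; *-identityˡ; reflexive)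
  renaming (refl to ≈-refl; sym to ≈-sym; trans to ≈-trans)
open SetoidReasoning setoid

-- The embedding of the integers

-- `i ℚ./ 1` is normalised through a gcd, which is stuck for a variable `i`. Among unnormalised
-- rationals it is just `i` over 1 (the `0` is the denominator minus one), so homomorphism laws
-- become integer identities.
toℚᵘ-/1 : ∀ i → ℚ.toℚᵘ (i ℚ./ 1) ℚᵘ.≃ mkℚᵘ i 0
toℚᵘ-/1 i = ℚₚ.toℚᵘ-fromℚᵘ (mkℚᵘ i 0)

/1-homo-+ : ∀ i j → (i ℤ.+ j) ℚ./ 1 ≡ i ℚ./ 1 ℚ.+ j ℚ./ 1
/1-homo-+ i j = ℚₚ.toℚᵘ-injective (ℚᵘₚ.≃-trans (toℚᵘ-/1 (i ℤ.+ j))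
  (ℚᵘₚ.≃-trans (*≡* (lemma i j)) (ℚᵘₚ.≃-sym (ℚᵘₚ.≃-trans (ℚₚ.toℚᵘ-homo-+ (i ℚ./ 1) (j ℚ./ 1))
    (ℚᵘₚ.+-cong (toℚᵘ-/1 i) (toℚᵘ-/1 j))))))
  where
  lemma : ∀ i j → (i ℤ.+ j) ℤ.* + 1 ≡ (i ℤ.* + 1 ℤ.+ j ℤ.* + 1) ℤ.* + 1
  lemma = ℤ-Solver.solve-∀

/1-homo-* : ∀ i j → (i ℤ.* j) ℚ./ 1 ≡ (i ℚ./ 1) ℚ.* (j ℚ./ 1)
/1-homo-* i j = ℚₚ.toℚᵘ-injective (ℚᵘₚ.≃-trans (toℚᵘ-/1 (i ℤ.* j))
  (ℚᵘₚ.≃-sym (ℚᵘₚ.≃-trans (ℚₚ.toℚᵘ-homo-* (i ℚ./ 1) (j ℚ./ 1))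
    (ℚᵘₚ.*-cong (toℚᵘ-/1 i) (toℚᵘ-/1 j)))))

/1-homo-neg : ∀ i → (ℤ.- i) ℚ./ 1 ≡ ℚ.- (i ℚ./ 1)
/1-homo-neg i = ℚₚ.toℚᵘ-injective (ℚᵘₚ.≃-trans (toℚᵘ-/1 (ℤ.- i))
  (ℚᵘₚ.≃-sym (ℚᵘₚ.≃-trans (ℚₚ.toℚᵘ-homo‿- (i ℚ./ 1)) (ℚᵘₚ.-‿cong (toℚᵘ-/1 i)))))

fromℤ-homo-+ : ∀ i j → fromℤ (i ℤ.+ j) ≈ fromℤ i + fromℤ j
fromℤ-homo-+ i j = ≗⇒≈ (λ _ → /1-homo-+ i j) , ≗⇒≈ (λ _ → ≡.refl)

fromℤ-homo-* : ∀ i j → fromℤ (i ℤ.* j) ≈ fromℤ i * fromℤ j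
fromℤ-homo-* i j =
  ≗⇒≈ (λ _ → ≡.trans (/1-homo-* i j) (≡.sym (ℚₚ.+-identityʳ _))) ,
  ≗⇒≈ (λ _ → ≡.sym (≡.cong₂ ℚ._+_ (ℚₚ.*-zeroʳ (i ℚ./ 1)) (ℚₚ.*-zeroˡ (j ℚ./ 1))))

fromℤ-homo-neg : ∀ i → fromℤ (ℤ.- i) ≈ - fromℤ i
fromℤ-homo-neg i = ≗⇒≈ (λ _ → /1-homo-neg i) , ≗⇒≈ (λ _ → ≡.refl)

fromℤ-morphism : CommutativeRing.rawRing ℤₚ.+-*-commutativeRing
                   -Raw-AlmostCommutative⟶ fromCommutativeRing ℂ-commutativeRing
fromℤ-morphism = record
  { ⟦_⟧    = fromℤ
  ; +-homo = fromℤ-homo-+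
  ; *-homo = fromℤ-homo-*
  ; -‿homo = fromℤ-homo-neg
  ; 0-homo = ≈-refl
  ; 1-homo = ≈-refl
  }

fromℤ-≟ : WeaklyDecidable (λ i j → fromℤ i ≈ fromℤ j)
fromℤ-≟ i j with i ℤ.≟ j
... | yes i≡j = just (reflexive (≡.cong fromℤ i≡j))
... | no _    = nothing

-- Equality on ℂ being undecidable, terms would not cancel with coefficients in ℂ.
open RingSolver _ (fromCommutativeRing ℂ-commutativeRing) fromℤ-morphism fromℤ-≟
  using (solve; con; _:=_; _:+_; _:*_; _:-_; :-_; _:^_)

-- Sequences indexed by ℤ

≡⇒≈ : ∀ (F : ℤ → ℂ) {i j} → i ≡ j → F i ≈ F j
≡⇒≈ F i≡j = reflexive (≡.cong F i≡j)

fibonacci-backwards : ∀ {F} → GeneralizedFibonacci F →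
  ∀ m → F m ≈ F (m ℤ.+ + 2) - F (m ℤ.+ + 1)
fibonacci-backwards {F} fib m = begin
  F m                                      ≈⟨ solve 2 (λ u v → v := u :+ v :- u) ≈-refl _ _ ⟩
  F (m ℤ.+ + 1) + F m - F (m ℤ.+ + 1)      ≈⟨ +-congʳ (≈-sym (fib m)) ⟩
  F (m ℤ.+ + 2) - F (m ℤ.+ + 1)            ∎

-- Induction upwards from 0 and 1, and downwards by solving the recurrence for its lowest term. It
-- reduces an identity in an integer index to the two cases 0 and 1.
fibonacci-unique : ∀ {F H} → GeneralizedFibonacci F → GeneralizedFibonacci H →
  F (+ 0) ≈ H (+ 0) → F (+ 1) ≈ H (+ 1) → ∀ m → F m ≈ H m
fibonacci-unique {F} {H} fibF fibH e₀ e₁ = go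
  where
  backwards : ∀ m → F (m ℤ.+ + 2) ≈ H (m ℤ.+ + 2) → F (m ℤ.+ + 1) ≈ H (m ℤ.+ + 1) → F m ≈ H m
  backwards m e₂ e₁ = begin
    F m                            ≈⟨ fibonacci-backwards fibF m ⟩
    F (m ℤ.+ + 2) - F (m ℤ.+ + 1)  ≈⟨ +-cong e₂ (-‿cong e₁) ⟩
    H (m ℤ.+ + 2) - H (m ℤ.+ + 1)  ≈⟨ fibonacci-backwards fibH m ⟨
    H m                            ∎

  forwards : ∀ {F} → GeneralizedFibonacci F → ∀ n → F (+ suc (suc n)) ≈ F (+ suc n) + F (+ n)
  forwards {F} fib n rewrite ℕₚ.+-comm 2 n | ℕₚ.+-comm 1 n = fib (+ n)

  go : ∀ m → F m ≈ H m
  go (+ 0)              = e₀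
  go (+ 1)              = e₁
  go (+ suc (suc n))    = begin
    F (+ suc (suc n))      ≈⟨ forwards {F} fibF n ⟩
    F (+ suc n) + F (+ n)  ≈⟨ +-cong (go (+ suc n)) (go (+ n)) ⟩
    H (+ suc n) + H (+ n)  ≈⟨ forwards {H} fibH n ⟨
    H (+ suc (suc n))      ∎
  -- Since `-[1+ k ]` is -(k+1), the indices `m + 1` and `m + 2` reduce to the ones already treated.
  go -[1+ 0 ]           = backwards -[1+ 0 ] e₁ e₀
  go -[1+ 1 ]           = backwards -[1+ 1 ] e₀ (go -[1+ 0 ])
  go -[1+ suc (suc n) ] = backwards -[1+ suc (suc n) ] (go -[1+ n ]) (go -[1+ suc n ])

-- Powers of -1 and the Lucas identity

[-1]^-suc : ∀ m → [-1]^ (m ℤ.+ + 1) ≈ - [-1]^ m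
[-1]^-suc (+ n) rewrite ℕₚ.+-comm n 1 =
  solve 1 (λ s → :- con (+ 1) :* s := :- s) ≈-refl _
-- Below zero the absolute value falls as `m` rises; the sign still flips because -1 is its own
-- inverse.
[-1]^-suc -[1+ 0 ] = solve 0 (con (+ 1) := :- (:- con (+ 1) :* con (+ 1))) ≈-refl
[-1]^-suc -[1+ suc n ] =
  solve 1 (λ s → s := :- (:- con (+ 1) :* s)) ≈-refl ((- 1#) ^ suc n)

[-1]^-* : ∀ m k → [-1]^ (m ℤ.* + k) ≈ ([-1]^ m) ^ k
[-1]^-* m k rewrite ℤₚ.abs-* m (+ k) = ≈-sym (Exp.^-assocʳ semiring (- 1#) ℤ.∣ m ∣ k)

-- For fixed `m` both sides are generalized Fibonacci sequences in `b`, so it suffices to compare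
-- them at 0 and 1.
lucas-identity : ∀ {G} → GeneralizedFibonacci G → ∀ b m →
  G (m ℤ.+ b) + [-1]^ b * G (m ℤ.- b) ≈ fromℤ (lucas b) * G m
lucas-identity {G} fib b m = fibonacci-unique {F} {H} fibF fibH F₀≈H₀ F₁≈H₁ b
  where
  F H : ℤ → ℂ
  F b = G (m ℤ.+ b) + [-1]^ b * G (m ℤ.- b)
  H b = fromℤ (lucas b) * G m

  F₀≈H₀ : F (+ 0) ≈ H (+ 0)
  F₀≈H₀ = begin
    G (m ℤ.+ + 0) + 1# * G (m ℤ.- + 0)
      ≈⟨ +-cong (≡⇒≈ G (ℤₚ.+-identityʳ m)) (*-congˡ (≡⇒≈ G (ℤₚ.+-identityʳ m))) ⟩
    G m + 1# * G m
      ≈⟨ solve 1 (λ g → g :+ con (+ 1) :* g := con (+ 2) :* g) ≈-refl (G m) ⟩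
    fromℤ (+ 2) * G m  ∎

  F₁≈H₁ : F (+ 1) ≈ H (+ 1)
  F₁≈H₁ = begin
    G (m ℤ.+ + 1) + [-1]^ (+ 1) * G (m ℤ.- + 1)
      -- Expanding from `m - 1` produces a `G (m - 1)` that cancels against the second summand.
      ≈⟨ +-congʳ (≡⇒≈ G (lemma₂ m)) ⟩
    G (m ℤ.- + 1 ℤ.+ + 2) + [-1]^ (+ 1) * G (m ℤ.- + 1)
      ≈⟨ +-congʳ (fib (m ℤ.- + 1)) ⟩
    G (m ℤ.- + 1 ℤ.+ + 1) + G (m ℤ.- + 1) + [-1]^ (+ 1) * G (m ℤ.- + 1)
      ≈⟨ solve 2 (λ g h → h :+ g :+ :- con (+ 1) :* con (+ 1) :* g := con (+ 1) :* h) ≈-refl _ _ ⟩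
    fromℤ (+ 1) * G (m ℤ.- + 1 ℤ.+ + 1)
      ≈⟨ *-congˡ (≡⇒≈ G (lemma₁ m)) ⟩
    fromℤ (+ 1) * G m ∎
    where
    lemma₁ : ∀ m → m ℤ.- + 1 ℤ.+ + 1 ≡ m
    lemma₁ = ℤ-Solver.solve-∀
    lemma₂ : ∀ m → m ℤ.+ + 1 ≡ m ℤ.- + 1 ℤ.+ + 2
    lemma₂ = ℤ-Solver.solve-∀

  fibH : GeneralizedFibonacci H
  fibH b = begin
    fromℤ (lucas (b ℤ.+ + 2)) * G m
      ≈⟨ *-congʳ (≡⇒≈ fromℤ (lucas-rec b)) ⟩
    fromℤ (lucas (b ℤ.+ + 1) ℤ.+ lucas b) * G m
      ≈⟨ *-congʳ (fromℤ-homo-+ (lucas (b ℤ.+ + 1)) (lucas b)) ⟩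
    (fromℤ (lucas (b ℤ.+ + 1)) + fromℤ (lucas b)) * G m
      ≈⟨ solve 3 (λ u v g → (u :+ v) :* g := u :* g :+ v :* g) ≈-refl _ _ _ ⟩
    H (b ℤ.+ + 1) + H b ∎

  fibF : GeneralizedFibonacci F
  fibF b = begin
    G (m ℤ.+ (b ℤ.+ + 2)) + [-1]^ (b ℤ.+ + 2) * g
      ≈⟨ +-cong G₂ (*-congʳ s₂) ⟩
    G (m ℤ.+ (b ℤ.+ + 1)) + G (m ℤ.+ b) + s * g
      -- The index `m - b` runs backwards, and the alternating sign repairs this: `s * g` equals
      -- `- s * h + s * (h + g)`.
      ≈⟨ solve 5 (λ u v s g h → u :+ v :+ s :* g := u :+ :- s :* h :+ (v :+ s :* (h :+ g)))
           ≈-refl (G (m ℤ.+ (b ℤ.+ + 1))) (G (m ℤ.+ b)) s g h ⟩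
    G (m ℤ.+ (b ℤ.+ + 1)) + - s * h + (G (m ℤ.+ b) + s * (h + g))
      ≈⟨ +-cong (+-congˡ (*-congʳ (≈-sym ([-1]^-suc b)))) (+-congˡ (*-congˡ (≈-sym G₋))) ⟩
    F (b ℤ.+ + 1) + F b ∎
    where
    s g h : ℂ
    s = [-1]^ b
    g = G (m ℤ.- (b ℤ.+ + 2))
    h = G (m ℤ.- (b ℤ.+ + 1))
    lemma₀ : ∀ m b → m ℤ.+ (b ℤ.+ + 2) ≡ m ℤ.+ b ℤ.+ + 2
    lemma₀ = ℤ-Solver.solve-∀
    lemma₁ : ∀ m b → m ℤ.+ b ℤ.+ + 1 ≡ m ℤ.+ (b ℤ.+ + 1)
    lemma₁ = ℤ-Solver.solve-∀
    lemma₂ : ∀ m b → m ℤ.- b ≡ m ℤ.- (b ℤ.+ + 2) ℤ.+ + 2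
    lemma₂ = ℤ-Solver.solve-∀
    lemma₃ : ∀ m b → m ℤ.- (b ℤ.+ + 2) ℤ.+ + 1 ≡ m ℤ.- (b ℤ.+ + 1)
    lemma₃ = ℤ-Solver.solve-∀
    G₂ : G (m ℤ.+ (b ℤ.+ + 2)) ≈ G (m ℤ.+ (b ℤ.+ + 1)) + G (m ℤ.+ b)
    G₂ = begin
      G (m ℤ.+ (b ℤ.+ + 2))                ≈⟨ ≡⇒≈ G (lemma₀ m b) ⟩
      G (m ℤ.+ b ℤ.+ + 2)                  ≈⟨ fib (m ℤ.+ b) ⟩
      G (m ℤ.+ b ℤ.+ + 1) + G (m ℤ.+ b)    ≈⟨ +-congʳ (≡⇒≈ G (lemma₁ m b)) ⟩
      G (m ℤ.+ (b ℤ.+ + 1)) + G (m ℤ.+ b)  ∎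
    G₋ : G (m ℤ.- b) ≈ h + g
    G₋ = begin
      G (m ℤ.- b)                            ≈⟨ ≡⇒≈ G (lemma₂ m b) ⟩
      G (m ℤ.- (b ℤ.+ + 2) ℤ.+ + 2)          ≈⟨ fib (m ℤ.- (b ℤ.+ + 2)) ⟩
      G (m ℤ.- (b ℤ.+ + 2) ℤ.+ + 1) + g      ≈⟨ +-congʳ (≡⇒≈ G (lemma₃ m b)) ⟩
      h + g                                  ∎
    s₂ : [-1]^ (b ℤ.+ + 2) ≈ s
    s₂ = begin
      [-1]^ (b ℤ.+ + 2)          ≈⟨ ≡⇒≈ [-1]^_ (≡.sym (ℤₚ.+-assoc b (+ 1) (+ 1))) ⟩
      [-1]^ (b ℤ.+ + 1 ℤ.+ + 1)  ≈⟨ [-1]^-suc (b ℤ.+ + 1) ⟩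
      - [-1]^ (b ℤ.+ + 1)        ≈⟨ -‿cong ([-1]^-suc b) ⟩
      - (- s)                    ≈⟨ solve 1 (λ s → :- (:- s) := s) ≈-refl s ⟩
      s                          ∎

-- Second-order recurrences

-- Sums unfold at their first term, whereas induction on the upper limit needs the last one split
-- off.
∑-suc : ∀ (f : ℕ → ℂ) n →
  ∑[ k ≤ suc n ] f (toℕ k) ≈ (∑[ k ≤ n ] f (toℕ k)) + f (suc n)
∑-suc f n = begin
  ∑[ k ≤ suc n ] f (toℕ k)
    ≈⟨ Sum.sum-init-last +-monoid {n = suc n} (λ k → f (toℕ k)) ⟩
  _ ≈⟨ +-cong (Sum.sum-cong-≋ +-monoid {n = suc n} (λ k → reflexive (≡.cong f (Finₚ.toℕ-inject₁ k))))
              (reflexive (≡.cong f (Finₚ.toℕ-fromℕ (suc n)))) ⟩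
  (∑[ k ≤ n ] f (toℕ k)) + f (suc n) ∎

module _ (p q x : ℂ) where

  Recurrent : (ℤ → ℂ) → Set
  Recurrent F = ∀ k → F (ℤ.suc k) ≈ p * F k - q * F (ℤ.pred k)

  D : (ℤ → ℂ) → ℤ → ℂ
  D F k = F k - q * x * F (ℤ.pred k)

  private
    -- For `p = fromℤ (lucas b)` and `q = [-1]^ b` this is `Δ b x` by definition.
    δ : ℂ
    δ = 1# - p * x + q * x ^ 2

  -- `D` combines shifts with constant coefficients, so it preserves the solutions; this allows
  -- `δ-D` to be applied to `D F` as well.
  D-recurrent : ∀ {F} → Recurrent F → Recurrent (D F)
  D-recurrent {F} rec k = begin
    F (ℤ.suc k) - q * x * F (ℤ.pred (ℤ.suc k))
      ≈⟨ +-cong (rec k) (-‿cong (*-congˡ F-pred-suc)) ⟩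
    (p * F k - q * g) - q * x * (p * g - q * h)
      ≈⟨ solve 6 (λ p q x f g h → (p :* f :- q :* g) :- q :* x :* (p :* g :- q :* h) :=
           p :* (f :- q :* x :* g) :- q :* (g :- q :* x :* h)) ≈-refl p q x (F k) g h ⟩
    p * D F k - q * D F (ℤ.pred k) ∎
    where
    g h : ℂ
    g = F (ℤ.pred k)
    h = F (ℤ.pred (ℤ.pred k))
    F-pred-suc : F (ℤ.pred (ℤ.suc k)) ≈ p * g - q * h
    F-pred-suc = begin
      F (ℤ.pred (ℤ.suc k))  ≈⟨ ≡⇒≈ F (≡.trans (ℤₚ.pred-suc k) (≡.sym (ℤₚ.suc-pred k))) ⟩
      F (ℤ.suc (ℤ.pred k))  ≈⟨ rec (ℤ.pred k) ⟩
      p * g - q * h         ∎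

  -- Once the recurrence replaces `F (ℤ.suc k)`, the terms in `F (ℤ.pred k)` cancel and `F k` is
  -- left with coefficient `δ`.
  δ-D : ∀ {F} → Recurrent F → ∀ k → δ * F k ≈ D F k - x * D F (ℤ.suc k)
  δ-D {F} rec k = begin
    δ * F k
      ≈⟨ solve 5 (λ p q x f g → (con (+ 1) :- p :* x :+ q :* x :^ 2) :* f :=
           f :- q :* x :* g :- x :* ((p :* f :- q :* g) :- q :* x :* f)) ≈-refl p q x (F k) _ ⟩
    D F k - x * ((p * F k - q * F (ℤ.pred k)) - q * x * F k)
      ≈⟨ +-congˡ (-‿cong (*-congˡ (+-cong (≈-sym (rec k))
           (-‿cong (*-congˡ (≡⇒≈ F (≡.sym (ℤₚ.pred-suc k)))))))) ⟩
    D F k - x * D F (ℤ.suc k) ∎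

  -- Summation by parts with denominators cleared. One `δ` turns the sum into the boundary term at
  -- `n + 1` plus the sum of `x ^ k * D F k` for k from 1 to `n + 1`; the second `δ` telescopes that
  -- sum. The proof runs this as an induction on `n`.
  weighted-sum : ∀ {F} → Recurrent F → ∀ n →
    δ * δ * (∑[ k ≤ n ] (x ^ toℕ k * fromℤ (+ toℕ k) * F (+ toℕ k)))
    ≈ - (δ * (fromℤ (+ suc n) * x ^ suc n * D F (+ suc n)))
      - (x ^ suc (suc n) * D (D F) (+ suc (suc n)) - x * D (D F) (+ 1))
  weighted-sum {F} rec zero = begin
    δ * δ * (1# * fromℤ (+ 0) * F (+ 0) + 0#)
      -- The weight 0 kills the left side. On the right the bracket cancels `x * (δ * D F 1)`, here
      -- already expanded by `δ-D` for `D F`.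
      ≈⟨ solve 5 (λ δ x f e e′ → δ :* δ :* (con (+ 1) :* con (+ 0) :* f :+ con (+ 0)) :=
           :- (con (+ 1) :* (x :* con (+ 1)) :* (e :- x :* e′))
             :- (x :* (x :* con (+ 1)) :* e′ :- x :* e))
           ≈-refl δ x (F (+ 0)) (D (D F) (+ 1)) (D (D F) (+ 2)) ⟩
    - (fromℤ (+ 1) * x ^ 1 * (D (D F) (+ 1) - x * D (D F) (+ 2))) - t
      ≈⟨ +-congʳ (-‿cong (*-congˡ (≈-sym (δ-D {D F} (D-recurrent rec) (+ 1))))) ⟩
    - (fromℤ (+ 1) * x ^ 1 * (δ * D F (+ 1))) - t
      ≈⟨ +-congʳ (-‿cong (solve 3 (λ c δ d → c :* (δ :* d) := δ :* (c :* d)) ≈-refl _ δ _)) ⟩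
    - (δ * (fromℤ (+ 1) * x ^ 1 * D F (+ 1))) - t ∎
    where
    t : ℂ
    t = x ^ 2 * D (D F) (+ 2) - x * D (D F) (+ 1)
  weighted-sum {F} rec (suc n) = begin
    δ * δ * (∑[ k ≤ suc n ] f (toℕ k))
      ≈⟨ *-congˡ (∑-suc f n) ⟩
    δ * δ * (S + y * c * F k)
      ≈⟨ solve 5 (λ δ s y c f → δ :* δ :* (s :+ y :* c :* f) :=
           δ :* δ :* s :+ δ :* (c :* y :* (δ :* f))) ≈-refl δ S y c (F k) ⟩
    δ * δ * S + δ * (c * y * (δ * F k))
      -- Expanding one `δ` of the new term yields `δ * (c * y * d)`, which cancels the old boundary
      -- term.
      ≈⟨ +-cong (weighted-sum rec n) (*-congˡ (*-congˡ (δ-D rec k))) ⟩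
    - (δ * (c * y * d)) - (x * y * e - t) + δ * (c * y * (d - x * d′))
      -- Adding and subtracting `x * (x * y) * e′` moves the bracket on to the next index. The
      -- remainder `e - x * e′` is `δ * d′`, which raises the boundary weight from `c` to `1 + c`.
      ≈⟨ solve 9 (λ δ x y c d d′ e e′ t →
           :- (δ :* (c :* y :* d)) :- (x :* y :* e :- t) :+ δ :* (c :* y :* (d :- x :* d′)) :=
           :- (c :* (x :* y) :* (δ :* d′)) :- x :* y :* (e :- x :* e′)
             :- (x :* (x :* y) :* e′ :- t)) ≈-refl δ x y c d d′ e e′ t ⟩
    - (c * (x * y) * (δ * d′)) - x * y * (e - x * e′) - (x * (x * y) * e′ - t)
      ≈⟨ +-congʳ (+-congˡ (-‿cong (*-congˡ
           (≈-sym (δ-D {D F} (D-recurrent rec) (+ suc (suc n))))))) ⟩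
    - (c * (x * y) * (δ * d′)) - x * y * (δ * d′) - (x * (x * y) * e′ - t)
      ≈⟨ +-congʳ (solve 5 (λ δ x y c d′ →
           :- (c :* (x :* y) :* (δ :* d′)) :- x :* y :* (δ :* d′) :=
           :- (δ :* ((con (+ 1) :+ c) :* (x :* y) :* d′))) ≈-refl δ x y c d′) ⟩
    - (δ * ((fromℤ (+ 1) + c) * (x * y) * d′)) - (x * (x * y) * e′ - t)
      ≈⟨ +-congʳ (-‿cong (*-congˡ (*-congʳ (*-congʳ (≈-sym (fromℤ-homo-+ (+ 1) k)))))) ⟩
    - (δ * (fromℤ (+ suc (suc n)) * (x * y) * d′)) - (x * (x * y) * e′ - t) ∎
    where
    k : ℤ
    k = + suc n
    f : ℕ → ℂ
    f k = x ^ k * fromℤ (+ k) * F (+ k)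
    S y c d d′ e e′ t : ℂ
    S = ∑[ k ≤ n ] f (toℕ k)
    y = x ^ suc n
    c = fromℤ k
    d = D F k
    d′ = D F (+ suc (suc n))
    e = D (D F) (+ suc (suc n))
    e′ = D (D F) (+ suc (suc (suc n)))
    t = x * D (D F) (+ 1)

-- The sequence H k = G (a + b k)

module _ (G : ℤ → ℂ) (a b : ℤ) (x : ℂ) where

  private
    H : ℤ → ℂ
    H k = G (a ℤ.+ b ℤ.* k)

    p q : ℂ
    p = fromℤ (lucas b)
    q = [-1]^ b

  -- This is `lucas-identity` at `m = a + b k`, solved for `G (m + b)`.
  progression-recurrent : GeneralizedFibonacci G → Recurrent p q x H
  progression-recurrent fib k = begin
    H (ℤ.suc k)
      ≈⟨ ≡⇒≈ G (lemma₁ a b k) ⟩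
    G (m ℤ.+ b)
      ≈⟨ solve 3 (λ u q v → u := u :+ q :* v :- q :* v) ≈-refl _ q _ ⟩
    G (m ℤ.+ b) + q * G (m ℤ.- b) - q * G (m ℤ.- b)
      ≈⟨ +-cong (lucas-identity fib b m) (-‿cong (*-congˡ (≡⇒≈ G (lemma₂ a b k)))) ⟩
    p * H k - q * H (ℤ.pred k) ∎
    where
    m : ℤ
    m = a ℤ.+ b ℤ.* k
    lemma₁ : ∀ a b k → a ℤ.+ b ℤ.* (+ 1 ℤ.+ k) ≡ a ℤ.+ b ℤ.* k ℤ.+ b
    lemma₁ = ℤ-Solver.solve-∀
    lemma₂ : ∀ a b k → a ℤ.+ b ℤ.* k ℤ.- b ≡ a ℤ.+ b ℤ.* (-[1+ 0 ] ℤ.+ k)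
    lemma₂ = ℤ-Solver.solve-∀

  -- The sign `(-1)^((b+1)k)` is the k-th power of `- q`, so `P` becomes the binomial expansion of
  -- the v-th power of `1 - q x E⁻¹`, applied to `H` at `w`.
  P-as-powers : ∀ v w → P G a b x v w ≈
    ∑[ k ≤ v ] (fromℤ (+ (v C toℕ k)) * (- q) ^ toℕ k * x ^ toℕ k * H (+ w ℤ.- + toℕ k))
  P-as-powers v w = Sum.sum-cong-≋ +-monoid {n = suc v} λ k →
    *-cong (*-congʳ {x ^ toℕ k} (*-congˡ {fromℤ (+ (v C toℕ k))} (sign (toℕ k))))
           (≡⇒≈ G (index a b (+ w) (+ toℕ k)))
    where
    sign : ∀ k → [-1]^ ((b ℤ.+ + 1) ℤ.* + k) ≈ (- q) ^ k
    sign k = ≈-trans ([-1]^-* (b ℤ.+ + 1) k) (Exp.^-congˡ semiring k ([-1]^-suc b))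
    index : ∀ a b w k → a ℤ.+ b ℤ.* w ℤ.- b ℤ.* k ≡ a ℤ.+ b ℤ.* (w ℤ.- k)
    index = ℤ-Solver.solve-∀

  private
    minus-0 : ∀ w → w ℤ.- + 0 ≡ w
    minus-0 = ℤ-Solver.solve-∀
    minus-1 : ∀ w → w ℤ.- + 1 ≡ ℤ.pred w
    minus-1 w = ℤₚ.+-comm w -[1+ 0 ]
    -- The right side is `ℤ.pred (ℤ.pred w)` unfolded, a form the ring solver can read.
    minus-2 : ∀ w → w ℤ.- + 2 ≡ -[1+ 0 ] ℤ.+ (-[1+ 0 ] ℤ.+ w)
    minus-2 = ℤ-Solver.solve-∀

  P₁ : ∀ w → P G a b x 1 w ≈ D p q x H (+ w)
  P₁ w = begin
    P G a b x 1 w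
      ≈⟨ P-as-powers 1 w ⟩
    fromℤ (+ 1) * 1# * 1# * H (+ w ℤ.- + 0) + (fromℤ (+ 1) * (- q) ^ 1 * x ^ 1 * H (+ w ℤ.- + 1) + 0#)
      ≈⟨ solve 4 (λ q x f g →
           con (+ 1) :* con (+ 1) :* con (+ 1) :* f
             :+ (con (+ 1) :* (:- q) :^ 1 :* x :^ 1 :* g :+ con (+ 0)) :=
           f :- q :* x :* g) ≈-refl q x _ _ ⟩
    H (+ w ℤ.- + 0) - q * x * H (+ w ℤ.- + 1)
      ≈⟨ +-cong (≡⇒≈ H (minus-0 (+ w))) (-‿cong (*-congˡ (≡⇒≈ H (minus-1 (+ w))))) ⟩
    D p q x H (+ w) ∎

  P₂ : ∀ w → P G a b x 2 w ≈ D p q x (D p q x H) (+ w)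
  P₂ w = begin
    P G a b x 2 w
      ≈⟨ P-as-powers 2 w ⟩
    fromℤ (+ 1) * 1# * 1# * H (+ w ℤ.- + 0) + (fromℤ (+ 2) * (- q) ^ 1 * x ^ 1 * H (+ w ℤ.- + 1)
      + (fromℤ (+ 1) * (- q) ^ 2 * x ^ 2 * H (+ w ℤ.- + 2) + 0#))
      -- The coefficients 1, 2, 1 regroup into two nested applications of `D`.
      ≈⟨ solve 5 (λ q x f g h →
           con (+ 1) :* con (+ 1) :* con (+ 1) :* f
             :+ (con (+ 2) :* (:- q) :^ 1 :* x :^ 1 :* g
             :+ (con (+ 1) :* (:- q) :^ 2 :* x :^ 2 :* h :+ con (+ 0))) :=
           (f :- q :* x :* g) :- q :* x :* (g :- q :* x :* h)) ≈-refl q x _ _ _ ⟩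
    (H (+ w ℤ.- + 0) - q * x * H (+ w ℤ.- + 1))
      - q * x * (H (+ w ℤ.- + 1) - q * x * H (+ w ℤ.- + 2))
      ≈⟨ +-cong (+-cong (≡⇒≈ H (minus-0 (+ w))) (-‿cong (*-congˡ e₁)))
           (-‿cong (*-congˡ (+-cong e₁ (-‿cong (*-congˡ (≡⇒≈ H (minus-2 (+ w)))))))) ⟩
    D p q x (D p q x H) (+ w) ∎
    where
    e₁ : H (+ w ℤ.- + 1) ≈ H (ℤ.pred (+ w))
    e₁ = ≡⇒≈ H (minus-1 (+ w))

-- Division by the square of `Δ`

mainTheorem2 : (G : ℤ → ℂ) → GeneralizedFibonacci G →
    (a b : ℤ) (n : ℕ) (x : ℂ) (Δ≠0 : Δ b x #0) →
    ∑[ k ≤ n ] (x ^ toℕ k * fromℤ (+ toℕ k) * G (a ℤ.+ b ℤ.* + toℕ k))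
    ≈ - (inv (Δ b x) Δ≠0 * fromℤ (+ (n ℕ.+ 1)) * x ^ (n ℕ.+ 1) * P G a b x 1 (n ℕ.+ 1))
      - inv (Δ b x) Δ≠0 ^ 2
        * (x ^ (n ℕ.+ 2) * P G a b x 2 (n ℕ.+ 2) - x * P G a b x 2 1)
mainTheorem2 G fib a b n x Δ≠0 rewrite ℕₚ.+-comm n 1 | ℕₚ.+-comm n 2 = begin
  S
    ≈⟨ ≈-trans (≈-sym (*-identityˡ S)) (*-congʳ (≈-sym δi*δi≈1)) ⟩
  (δ * i) * (δ * i) * S
    ≈⟨ solve 3 (λ δ i s → (δ :* i) :* (δ :* i) :* s := i :^ 2 :* (δ :* δ :* s)) ≈-refl δ i S ⟩
  i ^ 2 * (δ * δ * S)
    ≈⟨ *-congˡ (weighted-sum p q x (progression-recurrent G a b x fib) n) ⟩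
  i ^ 2 * (- (δ * (c * y * d)) - t)
    -- The boundary term still carries one `δ`, which absorbs one `i`; hence `Δ` divides it once but
    -- divides `t` twice.
    ≈⟨ solve 6 (λ δ i c y d t → i :^ 2 :* (:- (δ :* (c :* y :* d)) :- t) :=
         :- ((δ :* i) :* (i :* c :* y :* d)) :- i :^ 2 :* t) ≈-refl δ i c y d t ⟩
  - ((δ * i) * (i * c * y * d)) - i ^ 2 * t
    ≈⟨ +-congʳ (-‿cong (≈-trans (*-congʳ (*-inverse δ Δ≠0)) (*-identityˡ _))) ⟩
  - (i * c * y * d) - i ^ 2 * t
    ≈⟨ +-cong (-‿cong (*-congˡ (P₁ G a b x (suc n))))
         (-‿cong (*-congˡ (+-cong (*-congˡ (P₂ G a b x (suc (suc n))))
           (-‿cong (*-congˡ (P₂ G a b x 1)))))) ⟨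
  - (i * c * y * P G a b x 1 (suc n))
    - i ^ 2 * (x ^ suc (suc n) * P G a b x 2 (suc (suc n)) - x * P G a b x 2 1) ∎
  where
  H : ℤ → ℂ
  H k = G (a ℤ.+ b ℤ.* k)
  p q δ i S c y d t : ℂ
  p = fromℤ (lucas b)
  q = [-1]^ b
  δ = Δ b x
  i = inv (Δ b x) Δ≠0
  S = ∑[ k ≤ n ] (x ^ toℕ k * fromℤ (+ toℕ k) * H (+ toℕ k))
  c = fromℤ (+ suc n)
  y = x ^ suc n
  d = D p q x H (+ suc n)
  t = x ^ suc (suc n) * D p q x (D p q x H) (+ suc (suc n)) - x * D p q x (D p q x H) (+ 1)
  δi*δi≈1 : (δ * i) * (δ * i) ≈ 1#
  δi*δi≈1 = ≈-trans (*-cong (*-inverse δ Δ≠0) (*-inverse δ Δ≠0)) (*-identityˡ 1#)
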